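{- Let $\mathcal{S}$ be a relational structure admitting an injective unary FA-presentation $(a^*,\phi)$, and let $R$ be a binary relation in the signature of $\mathcal{S}$. Let $R^*$ denote the reflexive and transitive closure of $R$. Then $\Lambda(R^*,\phi)=\{(u,v)\in a^*\times a^* : (u\phi,v\phi)\in R^*\}$ is regular. Hence $\mathcal{S}$ augmented by the relation $R^*$ is also unary FA-presentable.
   Context: For words $w_1,\dots,w_r$ over a finite alphabet $A$, $\mathrm{conv}(w_1,\dots,w_r)$ is the word over $(A\cup\{\$\})^r$ (with $\$\notin A$) whose $j$-th letter is the tuple of $j$-th letters of the $w_i$, shorter words being padded at the end with $\$$ up to the maximal length. A relation $X\subseteq (A^*)^r$ is regular if $\{\mathrm{conv}(w_1,\dots,w_r):(w_1,\dots,w_r)\in X\}$ is a regular language. An FA-presentation of a relational structure $\mathcal{S}=(S,R_1,\dots,R_n)$ is a pair $(L,\phi)$ with $L$ a regular language over a finite alphabet and $\phi:L\to S$ surjective such that for every relation $R\in\{=,R_1,\dots,R_n\}$ of arity $r$ the relation $\Lambda(R,\phi)=\{(w_1,\dots,w_r)\in L^r : R(w_1\phi,\dots,w_r\phi)\}$ is regular. It is unary if $L$ is over a one-letter alphabet $\{a\}$, and a structure is unary FA-presentable if it admits a unary FA-presentation. An injective unary FA-presentation $(a^*,\phi)$ is one with $L=a^*$ and $\phi$ injective (hence bijective). -}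

module Defs where

open import Data.Bool.Base using (Bool; T)
open import Data.Fin.Base using (Fin)
open import Data.List.Base using (List; applyUpTo; drop; foldl; head; length; _∷ʳ_)
open import Data.List.Relation.Unary.All using (All)
open import Data.Maybe.Base using (Maybe)
open import Data.Nat.Base using (ℕ; _⊔_)
open import Data.Product.Base using (∃; _×_; _,_)
open import Data.Refinement using (Refinement; value)
open import Data.Vec.Base using (Vec; []; _∷_; foldr′; map)
open import Function.Definitions using (Surjective)
open import Level using (Level; 0ℓ; suc)
open import Relation.Binary.Construct.Closure.ReflexiveTransitive using (Star)
open import Relation.Binary.Core using (Rel)
open import Relation.Binary.PropositionalEquality.Core using (_≡_)
open import Relation.Unary using (Pred; _≐_)

private
  variable
    ℓ : Level
    k r : ℕ

record DFA (Σ : Set) : Set where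
  field
    states : ℕ
    start  : Fin states
    step   : Fin states → Σ → Fin states
    final  : Fin states → Bool

  Accepted : Pred (List Σ) 0ℓ
  Accepted w = T (final (foldl step start w))

-- Only used below for the finite alphabets Fin k and Vec (Maybe (Fin k)) r.
RegularLanguage : {Σ : Set} → Pred (List Σ) ℓ → Set ℓ
RegularLanguage {Σ = Σ} L = ∃ λ (M : DFA Σ) → DFA.Accepted M ≐ L

-- The padding symbol $ is `nothing`: head (drop j w) is the j-th letter
-- of w, or `nothing` if j is beyond the end of w.
conv : {A : Set} → Vec (List A) r → List (Vec (Maybe A) r)
conv ws = applyUpTo (λ j → map (λ w → head (drop j w)) ws)
                    (foldr′ _⊔_ 0 (map length ws))

RegularRelation : Pred (Vec (List (Fin k)) r) ℓ → Set ℓ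
RegularRelation X = RegularLanguage (λ u → ∃ λ ws → X ws × conv ws ≡ u)

record Structure (ℓ : Level) : Set (suc ℓ) where
  field
    Carrier   : Set ℓ
    relations : List (∃ λ r → Pred (Vec Carrier r) ℓ)

-- Refinement carries an irrelevant proof of membership, so a function
-- Words L → S depends on the word alone.
Words : Pred (List (Fin k)) 0ℓ → Set
Words {k = k} L = Refinement (List (Fin k)) L

Λ : {S : Set ℓ} {L : Pred (List (Fin k)) 0ℓ} →
    Pred (Vec S r) ℓ → (Words L → S) → Pred (Vec (List (Fin k)) r) ℓ
Λ {r = r} {L = L} R φ ws =
  ∃ λ (us : Vec (Words L) r) → map value us ≡ ws × R (map φ us)

binary : {S : Set ℓ} → Rel S ℓ → Pred (Vec S 2) ℓ
binary R (x ∷ y ∷ []) = R x y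

record IsFAPresentation (𝒮 : Structure ℓ) (L : Pred (List (Fin k)) 0ℓ)
                        (φ : Words L → Structure.Carrier 𝒮) : Set (suc ℓ) where
  open Structure 𝒮
  field
    regular           : RegularLanguage L
    surjective        : Surjective _≡_ _≡_ φ
    equalityRegular   : RegularRelation (Λ (binary _≡_) φ)
    relationsRegular  : All (λ (r , R) → RegularRelation (Λ R φ)) relations

UnaryFAPresentable : Structure ℓ → Set (suc ℓ)
UnaryFAPresentable 𝒮 =
  ∃ λ (L : Pred (List (Fin 1)) 0ℓ) →
  ∃ λ (φ : Words L → Structure.Carrier 𝒮) → IsFAPresentation 𝒮 L φ

infix 10 _⋆
_⋆ : {S : Set ℓ} → Pred (Vec S 2) ℓ → Pred (Vec S 2) ℓ
R ⋆ = binary (Star (λ x y → R (x ∷ y ∷ [])))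

augment : (𝒮 : Structure ℓ) → Pred (Vec (Structure.Carrier 𝒮) r) ℓ → Structure ℓ
augment {r = r} 𝒮 R = record
  { Carrier   = Carrier
  ; relations = relations ∷ʳ (r , R)
  }
  where open Structure 𝒮

{-# OPTIONS --safe #-}

-- Through φ, the relation R becomes a relation on ℕ accepted by a finite
-- automaton, which amounts to being eventually periodic: membership of (x , y)
-- is unchanged by adding a period p to both entries once both are large, and by
-- adding p to the larger entry once the difference is large.  Adding to such a
-- relation all shortcuts x → z of peaks x → y → z with y > x and y > z preserves
-- the threshold and the period.  Only finitely many relations share them, so the
-- process stabilises; afterwards every path can be replaced by a descent followed
-- by an ascent.  Ascents from a fixed point are recognised by a left-to-right scan
-- with finite memory, hence are eventually periodic, as are, by symmetry, descents
-- and then their composition through the lowest point.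

module Submission where

open import Defs
open import Data.Bool.Base using (Bool; false; if_then_else_; T)
open import Data.Bool.Properties using (T?)
open import Data.Fin.Base using (Fin; zero; suc; toℕ; fromℕ<; funToFin; finToFun)
open import Data.Fin.Properties using (pigeonhole; finToFun-funToFin; toℕ-fromℕ<; toℕ<n; toℕ≤pred[n]; +↔⊎; *↔×)
open import Data.Irrelevant using ([_])
import Data.List.Base as List
open import Data.List.Base using (List; []; _∷_; _++_; applyUpTo; catMaybes; drop; foldl; head; length; replicate)
open import Data.List.Membership.Propositional using (_∈_)
open import Data.List.Properties using (foldl-++; length-replicate; map-applyUpTo)
import Data.List.Relation.Unary.All as All
open import Data.List.Relation.Unary.All.Properties using (∷ʳ⁺)
open import Data.Maybe.Base using (Maybe; just; nothing)
open import Data.Nat.Base using (ℕ; zero; suc; _+_; _*_; _∸_; _^_; _!; _⊔_; _≤_; _<_; _≤′_; ≤′-refl; ≤′-step; z≤n; s≤s; z<s; s<s; NonZero; >-nonZero⁻¹)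
open import Data.Nat.Divisibility using (divides; ∣-trans; m∣m*n; m≤n⇒m!∣n!)
open import Data.Nat.GeneralisedArithmetic using (fold; fold-+)
open import Data.Nat.Properties
open import Data.Product.Base using (∃; ∃₂; _×_; _,_; proj₁; proj₂)
open import Data.Product.Function.NonDependent.Propositional using (_×-⇔_)
open import Data.Refinement using (value) renaming (_,_ to _,ʳ_)
open import Data.Sum.Base using (_⊎_; inj₁; inj₂; [_,_]′)
open import Data.Sum.Function.Propositional using (_⊎-⇔_; _⊎-↔_)
open import Data.Unit.Base using (tt)
open import Data.Vec.Base as Vec using (Vec; []; _∷_)
open import Function.Base using (_∘_; flip; id)
open import Function.Bundles using (_⇔_; mk⇔; Equivalence; _↔_; Inverse)
open import Function.Definitions using (Injective; Surjective)
open import Function.Properties.Equivalence using () renaming (refl to ⇔-refl; sym to ⇔-sym; trans to ⇔-trans)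
open import Function.Properties.Inverse using (↔-refl; ↔-trans)
open import Level using (Level; 0ℓ)
open import Relation.Binary.Construct.Closure.ReflexiveTransitive as Star using (Star; ε; _◅_; _◅◅_)
open import Relation.Binary.Core using (Rel; _⇒_)
open import Relation.Binary.Definitions using (tri<; tri≈; tri>) renaming (Decidable to Decidable₂)
open import Relation.Binary.PropositionalEquality
open import Relation.Nullary.Decidable using (Dec; yes; no; does; ⌊_⌋; toWitness; fromWitness; map′; _×-dec_; _⊎-dec_)
open import Relation.Nullary.Negation using (contradiction)
open import Relation.Unary using (Pred; Decidable; U)

open Equivalence using (to; from)

private
  variable
    ℓ : Level
    i j m n p t x y N : ℕ
    A B : Set
    P Q : Pred ℕ 0ℓ
    S : Rel ℕ 0ℓ

-- Eventually periodic predicates and relations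

≡⇒⇔ : A ≡ B → A ⇔ B
≡⇒⇔ refl = ⇔-refl

difference : m ≤ n → ∃ λ d → n ≡ d + m
difference {m} {n} m≤n = n ∸ m , sym (m∸n+n≡m m≤n)

+-swap : ∀ a b c → a + (b + c) ≡ b + (a + c)
+-swap a b c = trans (sym (+-assoc a b c)) (trans (cong (_+ c) (+-comm a b)) (+-assoc b a c))

Periodic : ℕ → ℕ → Pred ℕ 0ℓ → Set
Periodic t p P = ∀ {n} → t ≤ n → P n ⇔ P (p + n)

periodic-* : Periodic t p P → ∀ k → Periodic t (k * p) P
periodic-* per zero    t≤n = ⇔-refl
periodic-* {p = p} {P = P} per (suc k) {n} t≤n =
  ⇔-trans (periodic-* {P = P} per k t≤n)
  (⇔-trans (per (m≤n⇒m≤o+n (k * p) t≤n)) (≡⇒⇔ (cong P (sym (+-assoc p (k * p) n)))))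

-- The bound on the later index keeps both the start and the length of the repetition at most `N`,
-- whatever `σ` is.
recurrence : (σ : ℕ → Fin N) → ∃₂ λ i e → suc e + i ≤ N × σ i ≡ σ (suc e + i)
recurrence σ with pigeonhole ≤-refl (σ ∘ toℕ)
... | i , j , i<j , σᵢ≡σⱼ with difference i<j
... | e , j≡e+si =
  toℕ i , e , ≤-trans (≤-reflexive (sym j≡)) (toℕ≤pred[n] j) , trans σᵢ≡σⱼ (cong σ j≡)
  where
  j≡ : toℕ j ≡ suc e + toℕ i
  j≡ = trans j≡e+si (+-suc e (toℕ i))

-- N ! is a multiple of every possible recurrence distance, hence a period
-- that does not depend on the sequence.
recurrent⇒periodic : ∀ {b} (σ : ℕ → Fin N) →
  (∀ i e → σ i ≡ σ (suc e + i) → Periodic (i * p + b) (suc e * p) P) →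
  Periodic (N * p + b) (N ! * p) P
recurrent⇒periodic {N} {p} {P} {b} σ h {n} N*p+b≤n with recurrence σ
... | i , e , e+i≤N , eq with ∣-trans (m∣m*n (e !)) (m≤n⇒m!∣n! (m+n≤o⇒m≤o (suc e) e+i≤N))
... | divides k N!≡ =
  ⇔-trans (periodic-* {P = P} (h i e eq) k i*p+b≤n) (≡⇒⇔ (cong (λ d → P (d + n)) period≡))
  where
  i*p+b≤n : i * p + b ≤ n
  i*p+b≤n = ≤-trans (+-monoˡ-≤ b (*-monoˡ-≤ p (m+n≤o⇒n≤o (suc e) e+i≤N))) N*p+b≤n
  period≡ : k * (suc e * p) ≡ N ! * p
  period≡ = trans (sym (*-assoc k (suc e) p)) (cong (_* p) (sym N!≡))

-- Representatives of eventually periodic predicates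

module _ (t p : ℕ) .{{_ : NonZero p}} where

  -- Successor on a lasso with tail `t` and loop `p`: past the last point it returns to `t`.
  wrap : Fin (p + t) → Fin (p + t)
  wrap i with suc (toℕ i) <? p + t
  ... | yes i+1<p+t = fromℕ< i+1<p+t
  ... | no  _       = fromℕ< (m<n+m t (>-nonZero⁻¹ p))

  -- Iterating `wrap`, rather than dividing, lets an automaton follow the representative one letter
  -- at a time.
  rep : ℕ → Fin (p + t)
  rep zero    = fromℕ< (m≤n⇒m≤n+o t (>-nonZero⁻¹ p))
  rep (suc n) = wrap (rep n)

  private
    wrap-⇔ : Periodic t p P → ∀ i → P (suc (toℕ i)) ⇔ P (toℕ (wrap i))
    wrap-⇔ {P} per i with suc (toℕ i) <? p + t
    ... | yes i+1<p+t = ≡⇒⇔ (cong P (sym (toℕ-fromℕ< i+1<p+t)))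
    ... | no  i+1≮p+t =
      ⇔-trans (≡⇒⇔ (cong P (≤-antisym (toℕ<n i) (≮⇒≥ i+1≮p+t))))
      (⇔-trans (⇔-sym (per ≤-refl)) (≡⇒⇔ (cong P (sym (toℕ-fromℕ< _)))))

  -- The induction varies `P`: the hypothesis for `P ∘ suc` replaces `n` by its representative under
  -- the successor, and `wrap` absorbs that successor.
  rep-⇔ : Periodic t p P → ∀ n → P n ⇔ P (toℕ (rep n))
  rep-⇔ {P} per zero    = ≡⇒⇔ (cong P (sym (toℕ-fromℕ< _)))
  rep-⇔ {P} per (suc n) = ⇔-trans (rep-⇔ {P ∘ suc} per-suc n) (wrap-⇔ {P} per (rep n))
    where
    per-suc : Periodic t p (P ∘ suc)
    per-suc {n} t≤n = ⇔-trans (per (m≤n⇒m≤1+n t≤n)) (≡⇒⇔ (cong P (+-suc p n)))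

  periodic-∃? : Periodic t p P → Decidable P → Dec (∃ P)
  periodic-∃? {P} per P? = map′ (λ (n , _ , Pn) → n , Pn)
    (λ (n , Pn) → toℕ (rep n) , toℕ<n (rep n) , to (rep-⇔ {P} per n) Pn)
    (anyUpTo? P? (p + t))

-- Finite tables of predicates and relations

bit : Dec A → Fin 2
bit a? = if does a? then suc zero else zero

bit-injective : (a? : Dec A) (b? : Dec B) → bit a? ≡ bit b? → A ⇔ B
bit-injective (yes a) (yes b) _ = mk⇔ (λ _ → b) (λ _ → a)
bit-injective (no ¬a) (no ¬b) _ = mk⇔ (λ a → contradiction a ¬a) (λ b → contradiction b ¬b)

funToFin-injective : (f g : Fin m → Fin n) → funToFin f ≡ funToFin g → ∀ i → f i ≡ g i
funToFin-injective f g eq i =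
  trans (sym (finToFun-funToFin f i)) (trans (cong (λ c → finToFun c i) eq) (finToFun-funToFin g i))

code : ∀ N → Decidable P → Fin (2 ^ N)
code N P? = funToFin {N} (λ i → bit (P? (toℕ i)))

code-injective : (P? : Decidable P) (Q? : Decidable Q) → code N P? ≡ code N Q? →
                 ∀ i → P (toℕ {N} i) ⇔ Q (toℕ i)
code-injective {N = N} P? Q? eq i = bit-injective (P? (toℕ i)) (Q? (toℕ i)) (funToFin-injective {N} _ _ eq i)

code₂ : ∀ N → Decidable₂ S → Fin ((2 ^ N) ^ N)
code₂ N S? = funToFin {N} (λ i → code N (S? (toℕ i)))

-- Eventually periodic binary relations

record EventuallyPeriodic (t p : ℕ) (S : Rel ℕ 0ℓ) : Set where
  field
    shift : t ≤ x → t ≤ y → S x y ⇔ S (p + x) (p + y)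
    right : t + x ≤ y → S x y ⇔ S x (p + y)
    left  : t + y ≤ x → S x y ⇔ S (p + x) y

open EventuallyPeriodic

flip-periodic : EventuallyPeriodic t p S → EventuallyPeriodic t p (flip S)
flip-periodic per = record
  { shift = λ t≤x t≤y → shift per t≤y t≤x ; right = left per ; left = right per }

module _ (per : EventuallyPeriodic t p S) where

  offset-periodic : ∀ x → Periodic t p (λ d → S x (d + x))
  offset-periodic x {d} t≤d = ⇔-trans (right per (+-monoˡ-≤ x t≤d))
    (≡⇒⇔ (cong (S x) (sym (+-assoc p d x))))

  diagonal-periodic : ∀ d → Periodic t p (λ x → S x (d + x))
  diagonal-periodic d {x} t≤x = ⇔-trans (shift per t≤x (m≤n⇒m≤o+n d t≤x))
    (≡⇒⇔ (cong (S (p + x)) (+-swap p d x)))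

module _ {t p : ℕ} .{{_ : NonZero p}} where

  -- The smaller entry and the distance are reduced separately: first the distance at fixed `x`,
  -- then `x` at the reduced distance.
  rep₂-⇔ : EventuallyPeriodic t p S → ∀ x d →
           S x (d + x) ⇔ S (toℕ (rep t p x)) (toℕ (rep t p d) + toℕ (rep t p x))
  rep₂-⇔ {S} per x d = ⇔-trans
    (rep-⇔ t p {λ d → S x (d + x)} (offset-periodic per x) d)
    (rep-⇔ t p {λ x → S x (toℕ (rep t p d) + x)} (diagonal-periodic per (toℕ (rep t p d))) x)

  -- Every pair is equivalent to one in the square of side `K`, so relations sharing threshold and
  -- period are determined by finite tables.
  code₂-injective : ∀ {S T} → EventuallyPeriodic t p S → EventuallyPeriodic t p T →
    (S? : Decidable₂ S) (T? : Decidable₂ T) →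
    code₂ (p + t + (p + t)) S? ≡ code₂ (p + t + (p + t)) T? → S ⇒ T
  code₂-injective {S} {T} perS perT S? T? eq {x} {y} = [ upper , lower ]′ (≤-total x y)
    where
    -- The larger entry of a reduced pair is a sum of two representatives, each below `p + t`.
    K : ℕ
    K = p + t + (p + t)
    r : ℕ → ℕ
    r = toℕ ∘ rep t p
    rep< : ∀ n → r n < p + t
    rep< n = toℕ<n (rep t p n)

    square : ∀ {x y} → x < K → y < K → S x y → T x y
    square x< y< = subst₂ (λ x y → S x y → T x y) (toℕ-fromℕ< x<) (toℕ-fromℕ< y<)
      (to (code-injective (S? _) (T? _)
        (funToFin-injective {K} (λ i → code K (S? (toℕ i))) (λ i → code K (T? (toℕ i))) eq (fromℕ< x<)) (fromℕ< y<)))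

    upper : x ≤ y → S x y → T x y
    upper x≤y with difference x≤y
    ... | d , refl = from (rep₂-⇔ perT x d)
      ∘ square (m≤n⇒m≤n+o _ (rep< x)) (+-mono-< (rep< d) (rep< x))
      ∘ to (rep₂-⇔ perS x d)

    lower : y ≤ x → S x y → T x y
    lower y≤x with difference y≤x
    ... | d , refl = from (rep₂-⇔ (flip-periodic perT) y d)
      ∘ square (+-mono-< (rep< d) (rep< y)) (m≤n⇒m≤n+o _ (rep< y))
      ∘ to (rep₂-⇔ (flip-periodic perS) y d)

-- Peak elimination

Peak : Rel ℕ 0ℓ → Rel ℕ 0ℓ
Peak S x z = ∃ λ y → x < y × z < y × S x y × S y z

saturate : Rel ℕ 0ℓ → ℕ → Rel ℕ 0ℓ
saturate S zero        = S
saturate S (suc k) x z = saturate S k x z ⊎ Peak (saturate S k) x z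

saturate-mono : i ≤ j → saturate S i ⇒ saturate S j
saturate-mono i≤j = go (≤⇒≤′ i≤j)
  where
  go : i ≤′ j → saturate S i ⇒ saturate S j
  go ≤′-refl       s = s
  go (≤′-step i≤j) s = inj₁ (go i≤j s)

saturate⇒Star : ∀ k → saturate S k ⇒ Star S
saturate⇒Star zero    s = s ◅ ε
saturate⇒Star (suc k) (inj₁ s) = saturate⇒Star k s
saturate⇒Star (suc k) (inj₂ (_ , _ , _ , s , s′)) = saturate⇒Star k s ◅◅ saturate⇒Star k s′

-- Translation by `p` carries witnesses to witnesses; the lower bound on those of `Q` makes it
-- invertible.
∃-shift : ∀ p {P Q : Pred ℕ 0ℓ} → (∀ {y} → Q y → p ≤ y) → (∀ {y} → P y ⇔ Q (p + y)) → ∃ P ⇔ ∃ Q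
∃-shift p {P} {Q} p≤ P⇔Q = mk⇔ (λ (y , Py) → p + y , to P⇔Q Py) back
  where
  back : ∃ Q → ∃ P
  back (y , Qy) with difference (p≤ Qy)
  ... | d , refl = d , from P⇔Q (subst Q (+-comm d p) Qy)

<-shift : ∀ p → x < y ⇔ p + x < p + y
<-shift p = mk⇔ (+-monoʳ-< p) (+-cancelˡ-< p _ _)

×-⇔-dependent : {C D : Set} → A ⇔ B → (A → C ⇔ D) → (A × C) ⇔ (B × D)
×-⇔-dependent f g = mk⇔ (λ (a , c) → to f a , to (g a) c) (λ (b , d) → from f b , from (g (from f b)) d)

-- The apex lies above both ends, so it can move by `p` with whichever end moves, and above a
-- translated end it is itself at least `p`. If one end is far above the other, so is the apex;
-- hence neither threshold nor period grows.
Peak-periodic : EventuallyPeriodic t p S → EventuallyPeriodic t p (Peak S)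
Peak-periodic {t} {p} {S} per = record
  { shift = λ t≤x t≤z → ∃-shift p (λ (px<y , _) → m+n≤o⇒m≤o p (<⇒≤ px<y))
      (×-⇔-dependent (<-shift p) λ x<y → <-shift p ×-⇔
        (shift per t≤x (≤-trans t≤x (<⇒≤ x<y)) ×-⇔ shift per (≤-trans t≤x (<⇒≤ x<y)) t≤z))
  ; right = λ {x} {z} t+x≤z → ∃-shift p (λ (_ , pz<y , _) → m+n≤o⇒m≤o p (<⇒≤ pz<y))
      (mk⇔
        (λ (x<y , z<y , s , s′) → let t+x≤y = ≤-trans t+x≤z (<⇒≤ z<y) ; t≤z = m+n≤o⇒m≤o t t+x≤z in
          m≤n⇒m≤o+n p x<y , +-monoʳ-< p z<y , to (right per t+x≤y) s ,
          to (shift per (m+n≤o⇒m≤o t t+x≤y) t≤z) s′)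
        (λ (_ , pz<py , s , s′) → let z<y = +-cancelˡ-< p _ _ pz<py ; t+x≤y = ≤-trans t+x≤z (<⇒≤ z<y) ; t≤z = m+n≤o⇒m≤o t t+x≤z in
          ≤-<-trans (m+n≤o⇒n≤o t t+x≤z) z<y , z<y , from (right per t+x≤y) s ,
          from (shift per (m+n≤o⇒m≤o t t+x≤y) t≤z) s′))
  ; left = λ {z} {x} t+z≤x → ∃-shift p (λ (px<y , _) → m+n≤o⇒m≤o p (<⇒≤ px<y))
      (mk⇔
        (λ (x<y , z<y , s , s′) → let t+z≤y = ≤-trans t+z≤x (<⇒≤ x<y) ; t≤x = m+n≤o⇒m≤o t t+z≤x in
          +-monoʳ-< p x<y , m≤n⇒m≤o+n p z<y , to (shift per t≤x (m+n≤o⇒m≤o t t+z≤y)) s ,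
          to (left per t+z≤y) s′)
        (λ (px<py , _ , s , s′) → let x<y = +-cancelˡ-< p _ _ px<py ; t+z≤y = ≤-trans t+z≤x (<⇒≤ x<y) ; t≤x = m+n≤o⇒m≤o t t+z≤x in
          x<y , ≤-<-trans (m+n≤o⇒n≤o t t+z≤x) x<y , from (shift per t≤x (m+n≤o⇒m≤o t t+z≤y)) s ,
          from (left per t+z≤y) s′))
  }

⊎-periodic : ∀ {S T} → EventuallyPeriodic t p S → EventuallyPeriodic t p T →
             EventuallyPeriodic t p (λ x y → S x y ⊎ T x y)
⊎-periodic perS perT = record
  { shift = λ t≤x t≤y → shift perS t≤x t≤y ⊎-⇔ shift perT t≤x t≤y
  ; right = λ t+x≤y → right perS t+x≤y ⊎-⇔ right perT t+x≤y
  ; left  = λ t+y≤x → left perS t+y≤x ⊎-⇔ left perT t+y≤x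
  }

saturate-periodic : EventuallyPeriodic t p S → ∀ k → EventuallyPeriodic t p (saturate S k)
saturate-periodic per zero    = per
saturate-periodic per (suc k) = ⊎-periodic (saturate-periodic per k) (Peak-periodic (saturate-periodic per k))

module _ {t p : ℕ} .{{_ : NonZero p}} where

  -- Both steps through the apex are eventually periodic in its height above the ends, so the
  -- unbounded search for an apex becomes finite.
  Peak? : EventuallyPeriodic t p S → Decidable₂ S → Decidable₂ (Peak S)
  Peak? {S} per S? x z = map′
    (λ (d , s , s′) → d + h , m≤n⇒m≤o+n d (s≤s (m≤m⊔n x z)) , m≤n⇒m≤o+n d (s≤s (m≤n⊔m x z)) , s , s′)
    back
    (periodic-∃? t p {Top} Top-periodic (λ d → S? x (d + h) ×-dec S? (d + h) z))
    where
    h : ℕ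
    h = suc (x ⊔ z)
    Top : Pred ℕ 0ℓ
    Top d = S x (d + h) × S (d + h) z
    Top-periodic : Periodic t p Top
    Top-periodic {d} t≤d = ⇔-trans
      (right per (+-mono-≤ t≤d (m≤n⇒m≤1+n (m≤m⊔n x z))) ×-⇔ left per (+-mono-≤ t≤d (m≤n⇒m≤1+n (m≤n⊔m x z))))
      (≡⇒⇔ (cong (λ y → S x y × S y z) (sym (+-assoc p d h))))
    back : Peak S x z → ∃ Top
    back (y , x<y , z<y , s , s′) with difference (⊔-lub x<y z<y)
    ... | d , refl = d , s , s′

  saturate? : EventuallyPeriodic t p S → Decidable₂ S → ∀ k → Decidable₂ (saturate S k)
  saturate? per S? zero        = S?
  saturate? per S? (suc k) x z =
    saturate? per S? k x z ⊎-dec Peak? (saturate-periodic per k) (saturate? per S? k) x z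

  -- Rounds `i` and `suc e + i` share a table, hence are the same relation; a peak of round `i`
  -- enters at the next round, so it already belongs to round `i`.
  saturation-stabilises : EventuallyPeriodic t p S → Decidable₂ S →
                          ∃ λ k → Peak (saturate S k) ⇒ saturate S k
  saturation-stabilises {S} per S? with recurrence (λ k → code₂ (p + t + (p + t)) (saturate? per S? k))
  ... | i , e , _ , eq = i , λ peak →
    code₂-injective (saturate-periodic per _) (saturate-periodic per i)
      (saturate? per S? _) (saturate? per S? i) (sym eq) (saturate-mono {S = S} (s≤s (m≤n+m i e)) (inj₂ peak))

-- Decomposing paths into a descent and an ascent

Ascending : Rel ℕ 0ℓ → Rel ℕ 0ℓ
Ascending S x y = x < y × S x y

-- Both relations are read upwards from the low point `c`: descents enter as ascents of the flipped
-- relation, so one analysis serves both.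
Valley : Rel ℕ 0ℓ → Rel ℕ 0ℓ → Rel ℕ 0ℓ
Valley D U x z = ∃ λ c → (c ≤ x × D c x) × (c ≤ z × U c z)

ascending-≤ : Star (Ascending S) x y → x ≤ y
ascending-≤ ε             = ≤-refl
ascending-≤ ((x<y , _) ◅ ys) = ≤-trans (<⇒≤ x<y) (ascending-≤ ys)

module _ (closed : Peak S ⇒ S) where

  private
    Descending : Rel ℕ 0ℓ
    Descending x y = y < x × S x y

    -- An upward step before a descent forms a peak with its first step; closure merges the two and
    -- shortens the descent, until the new step is trivial, goes down, or has no descent left to
    -- meet.
    prepend : ∀ {x y c z} → S x y → Star Descending y c → Star (Ascending S) c z →
              ∃ λ c → Star Descending x c × Star (Ascending S) c z
    prepend {x} {y} s down up with <-cmp x y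
    prepend s down up                 | tri≈ _ refl _ = _ , down , up
    prepend s down up                 | tri> _ _ y<x  = _ , (y<x , s) ◅ down , up
    prepend s ε up                    | tri< x<y _ _  = _ , ε , (x<y , s) ◅ up
    prepend s ((y′<y , s′) ◅ down) up | tri< x<y _ _  = prepend (closed (_ , x<y , y′<y , s , s′)) down up

    down-up : Star S x y → ∃ λ c → Star Descending x c × Star (Ascending S) c y
    down-up ε        = _ , ε , ε
    down-up (s ◅ ss) = let _ , down , up = down-up ss in prepend s down up

  Star⇒Valley : Star S ⇒ Valley (Star (Ascending (flip S))) (Star (Ascending S))
  Star⇒Valley ss with down-up ss
  ... | c , down , up = c , (ascending-≤ down⁻¹ , down⁻¹) , (ascending-≤ up , up)
    where
    down⁻¹ : Star (Ascending (flip S)) c _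
    down⁻¹ = Star.reverse id down

Valley⇒Star : Valley (Star (Ascending (flip S))) (Star (Ascending S)) ⇒ Star S
Valley⇒Star (c , (_ , down) , (_ , up)) = Star.reverse proj₂ down ◅◅ Star.map proj₂ up

-- A low point beyond `t` moves with the ends; a smaller one stays put, being far below both. Moving
-- back needs `c ∸ p` to stay beyond `t`, so all `c ≤ t + p` must be able to stay put, which is what
-- the threshold `t + (t + p)` ensures.
Valley-periodic : ∀ {D U} → EventuallyPeriodic t p D → EventuallyPeriodic t p U →
                  EventuallyPeriodic (t + (t + p)) p (Valley D U)
Valley-periodic {t} {p} {D} {U} perD perU = record
  { shift = λ θ≤x θ≤z → mk⇔ (forth θ≤x θ≤z) (back θ≤x θ≤z)
  ; right = λ {x} {z} θ+x≤z → mk⇔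
      (λ (c , (c≤x , d) , (c≤z , u)) → c , (c≤x , d) , (m≤n⇒m≤o+n p c≤z , to (right perU (far c≤x θ+x≤z)) u))
      (λ (c , (c≤x , d) , (_ , u)) → c , (c≤x , d) , (≤-trans c≤x (m+n≤o⇒n≤o θ θ+x≤z) , from (right perU (far c≤x θ+x≤z)) u))
  ; left = λ {z} {x} θ+z≤x → mk⇔
      (λ (c , (c≤x , d) , (c≤z , u)) → c , (m≤n⇒m≤o+n p c≤x , to (right perD (far c≤z θ+z≤x)) d) , (c≤z , u))
      (λ (c , (_ , d) , (c≤z , u)) → c , (≤-trans c≤z (m+n≤o⇒n≤o θ θ+z≤x) , from (right perD (far c≤z θ+z≤x)) d) , (c≤z , u))
  }
  where
  θ : ℕ
  θ = t + (t + p)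

  far : ∀ {c x z} → c ≤ x → θ + x ≤ z → t + c ≤ z
  far c≤x θ+x≤z = ≤-trans (+-mono-≤ (m≤m+n t (t + p)) c≤x) θ+x≤z

  near : ∀ {c x} → c ≤ t + p → θ ≤ x → t + c ≤ x
  near c≤t+p θ≤x = ≤-trans (+-monoʳ-≤ t c≤t+p) θ≤x

  forth : ∀ {x z} → θ ≤ x → θ ≤ z → Valley D U x z → Valley D U (p + x) (p + z)
  forth θ≤x θ≤z (c , (c≤x , d) , (c≤z , u)) with ≤-total t c
  ... | inj₁ t≤c = p + c ,
    (+-monoʳ-≤ p c≤x , to (shift perD t≤c (≤-trans t≤c c≤x)) d) ,
    (+-monoʳ-≤ p c≤z , to (shift perU t≤c (≤-trans t≤c c≤z)) u)
  ... | inj₂ c≤t = c ,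
    (m≤n⇒m≤o+n p c≤x , to (right perD (near (m≤n⇒m≤n+o p c≤t) θ≤x)) d) ,
    (m≤n⇒m≤o+n p c≤z , to (right perU (near (m≤n⇒m≤n+o p c≤t) θ≤z)) u)

  back : ∀ {x z} → θ ≤ x → θ ≤ z → Valley D U (p + x) (p + z) → Valley D U x z
  back {x} {z} θ≤x θ≤z (c , (c≤x , d) , (c≤z , u)) with ≤-total (t + p) c
  ... | inj₂ c≤t+p = c ,
    (m+n≤o⇒n≤o t (near c≤t+p θ≤x) , from (right perD (near c≤t+p θ≤x)) d) ,
    (m+n≤o⇒n≤o t (near c≤t+p θ≤z) , from (right perU (near c≤t+p θ≤z)) u)
  ... | inj₁ t+p≤c with difference (m+n≤o⇒n≤o t t+p≤c)
  ... | e , refl = e ,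
    (e≤x , from (shift perD t≤e (≤-trans t≤e e≤x)) (subst (λ c → D c (p + x)) (+-comm e p) d)) ,
    (e≤z , from (shift perU t≤e (≤-trans t≤e e≤z)) (subst (λ c → U c (p + z)) (+-comm e p) u))
    where
    t≤e : t ≤ e
    t≤e = +-cancelʳ-≤ p _ _ t+p≤c
    e≤x : e ≤ x
    e≤x = +-cancelˡ-≤ p _ _ (subst (_≤ p + x) (+-comm e p) c≤x)
    e≤z : e ≤ z
    e≤z = +-cancelˡ-≤ p _ _ (subst (_≤ p + z) (+-comm e p) c≤z)

Valley? : ∀ {D U} → Decidable₂ D → Decidable₂ U → Decidable₂ (Valley D U)
Valley? D? U? x z = map′
  (λ (c , _ , v) → c , v)
  (λ (c , (c≤x , d) , v) → c , s≤s c≤x , (c≤x , d) , v)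
  (anyUpTo? (λ c → (c ≤? x ×-dec D? c x) ×-dec (c ≤? z ×-dec U? c z)) (suc x))

-- Ascents from a fixed point

module _ {t p : ℕ} .{{_ : NonZero p}} {S : Rel ℕ 0ℓ} (per : EventuallyPeriodic t p S) (S? : Decidable₂ S) where

  private
    Ascent : Rel ℕ 0ℓ
    Ascent = Star (Ascending S)

  -- `Star` exposes the first step of a path, whereas the scan decides a point by the last step into
  -- it.
  unsnoc : Ascent x y → x ≡ y ⊎ ∃ λ v → v < y × Ascent x v × S v y
  unsnoc ε = inj₁ refl
  unsnoc ((x<y , s) ◅ ss) with unsnoc ss
  ... | inj₁ refl                 = inj₂ (_ , x<y , ε , s)
  ... | inj₂ (v , v<y , ss′ , s′) = inj₂ (v , v<y , (x<y , s) ◅ ss′ , s′)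

  snoc : x < y → Ascent n x → S x y → Ascent n y
  snoc x<y ss s = ss ◅◅ (x<y , s) ◅ ε

  ascent? : Decidable₂ Ascent
  ascent? c n = below (suc n) n ≤-refl
    where
    below : ∀ m n → n < m → Dec (Ascent c n)
    below (suc m) n (s≤s n≤m) = map′
      [ (λ { refl → ε }) , (λ (v , v<n , (_ , ss) , s) → snoc v<n ss s) ]′
      ([ inj₁ , (λ (v , v<n , ss , s) → inj₂ (v , v<n , (v<n , ss) , s)) ]′ ∘ unsnoc)
      (c ≟ n ⊎-dec anyUpTo? (λ v → reached? v ×-dec S? v n) n)
      where
      -- The search wants a decision at every `v`, but recursion is available only below `n`; the
      -- bound therefore becomes part of the predicate.
      reached? : ∀ v → Dec (v < n × Ascent c v)
      reached? v with v <? n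
      ... | no  v≮n = no (v≮n ∘ proj₁)
      ... | yes v<n = map′ (v<n ,_) proj₂ (below m v (≤-trans v<n n≤m))

  module _ (c : ℕ) where

    -- The memory of a left-to-right scan that has decided all points below n;
    -- being periodic in k, it ranges over finitely many predicates.
    Pending : ℕ → Pred ℕ 0ℓ
    Pending n k = ∃ λ v → v < n × Ascent c v × S v (k + n)

    pending? : ∀ n → Decidable (Pending n)
    pending? n k = anyUpTo? (λ v → ascent? c v ×-dec S? v (k + n)) n

    pending-periodic : ∀ n → Periodic t p (Pending n)
    pending-periodic n {k} t≤k = mk⇔
      (λ (v , v<n , ss , s) → v , v<n , ss , to (step v<n) s)
      (λ (v , v<n , ss , s) → v , v<n , ss , from (step v<n) s)
      where
      step : ∀ {v} → v < n → S v (k + n) ⇔ S v (p + k + n)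
      step {v} v<n = ⇔-trans (right per (+-mono-≤ t≤k (<⇒≤ v<n))) (≡⇒⇔ (cong (S v) (sym (+-assoc p k n))))

    ascent⇔pending : c < n → Ascent c n ⇔ Pending n 0
    ascent⇔pending c<n = mk⇔
      ([ (λ c≡n → contradiction c≡n (<⇒≢ c<n)) , id ]′ ∘ unsnoc)
      (λ (v , v<n , ss , s) → snoc v<n ss s)

    -- The update rule of the scan: a source of a pending step lies before `n` or is `n` itself, and
    -- `n` is reached exactly when `Pending n 0` holds.
    pending-suc : c < n → ∀ k → (Pending n (suc k) ⊎ (Pending n 0 × S n (suc k + n))) ⇔ Pending (suc n) k
    pending-suc {n} c<n k = mk⇔ forth back
      where
      forth : Pending n (suc k) ⊎ (Pending n 0 × S n (suc k + n)) → Pending (suc n) k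
      forth (inj₁ (v , v<n , ss , s)) = v , m<n⇒m<1+n v<n , ss , subst (S v) (sym (+-suc k n)) s
      forth (inj₂ (w , s)) = n , ≤-refl , from (ascent⇔pending c<n) w , subst (S n) (sym (+-suc k n)) s
      back : Pending (suc n) k → Pending n (suc k) ⊎ (Pending n 0 × S n (suc k + n))
      back (v , v<1+n , ss , s) with m<1+n⇒m<n∨m≡n v<1+n
      ... | inj₁ v<n  = inj₁ (v , v<n , ss , subst (S v) (+-suc k n) s)
      ... | inj₂ refl = inj₂ (to (ascent⇔pending c<n) ss , subst (S n) (+-suc k n) s)

    -- Besides the memory, the update uses only `S n (suc k + n)`, which is periodic in `n` beyond
    -- `t`; equal memories a multiple of `p` apart thus stay equal.
    pending-deterministic : ∀ e → c < n → t ≤ n →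
      (∀ k → Pending n k ⇔ Pending (e * p + n) k) →
      ∀ j k → Pending (j + n) k ⇔ Pending (e * p + (j + n)) k
    pending-deterministic e c<n t≤n same zero    k = same k
    pending-deterministic {n} e c<n t≤n same (suc j) k =
      ⇔-trans (⇔-sym (pending-suc (m≤n⇒m≤o+n j c<n) k))
      (⇔-trans
        (same′ (suc k) ⊎-⇔ (same′ 0 ×-⇔
          periodic-* {P = λ x → S x (suc k + x)} (diagonal-periodic per (suc k)) e (m≤n⇒m≤o+n j t≤n)))
      (⇔-trans (pending-suc (m≤n⇒m≤o+n (e * p) (m≤n⇒m≤o+n j c<n)) k)
        (≡⇒⇔ (cong (λ m → Pending m k) (sym (+-suc (e * p) (j + n)))))))
      where
      same′ = pending-deterministic e c<n t≤n same j

    -- The memory, sampled at positions `p` apart, takes at most `2 ^ (p + t)` values, and its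
    -- recurrence repeats the scan from there on. The offset `suc t + c` puts every sample beyond
    -- both `c` and `t`.
    ascent-periodic : let N = 2 ^ (p + t) in Periodic (N * p + (suc t + c)) (N ! * p) (Ascent c)
    ascent-periodic = recurrent⇒periodic {P = Ascent c} σ recur
      where
      b : ℕ
      b = suc t + c
      σ : ℕ → Fin (2 ^ (p + t))
      σ i = code (p + t) (pending? (i * p + b))
      recur : ∀ i e → σ i ≡ σ (suc e + i) → Periodic (i * p + b) (suc e * p) (Ascent c)
      recur i e eq {n} n₀≤n with difference n₀≤n
      ... | j , refl =
        ⇔-trans (ascent⇔pending c<n)
        (⇔-trans (pending-deterministic (suc e) c<n₀ t≤n₀ same j 0)
        (⇔-sym (ascent⇔pending (m≤n⇒m≤o+n (suc e * p) c<n))))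
        where
        n₀ n₁ : ℕ
        n₀ = i * p + b
        n₁ = (suc e + i) * p + b
        c<n₀ : c < n₀
        c<n₀ = m≤n⇒m≤o+n (i * p) (s≤s (m≤n+m c t))
        t≤n₀ : t ≤ n₀
        t≤n₀ = m≤n⇒m≤o+n (i * p) (m≤n⇒m≤1+n (m≤m+n t c))
        c<n : c < j + n₀
        c<n = m≤n⇒m≤o+n j c<n₀
        n₁≡ : n₁ ≡ suc e * p + n₀
        n₁≡ = trans (cong (_+ b) (*-distribʳ-+ p (suc e) i)) (+-assoc (suc e * p) (i * p) b)
        -- The code records only `k < p + t`; periodicity of both memories in `k` extends the
        -- agreement to all `k`.
        same : ∀ k → Pending n₀ k ⇔ Pending (suc e * p + n₀) k
        same k = ⇔-trans (rep-⇔ t p {Pending n₀} (pending-periodic n₀) k)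
          (⇔-trans (code-injective (pending? n₀) (pending? n₁) eq (rep t p k))
          (⇔-trans (⇔-sym (rep-⇔ t p {Pending n₁} (pending-periodic n₁) k))
          (≡⇒⇔ (cong (λ m → Pending m k) n₁≡))))

  -- An ascent that starts beyond `t` stays there, so `shift` applies to each of its steps.
  ascent-shift : t ≤ x → Ascent x y ⇔ Ascent (p + x) (p + y)
  ascent-shift {x} {y} t≤x = mk⇔ (forth t≤x) (λ ss → back t≤x ss refl refl)
    where
    forth : ∀ {x} → t ≤ x → Ascent x y → Ascent (p + x) (p + y)
    forth t≤x ε = ε
    forth t≤x ((x<z , s) ◅ ss) = (+-monoʳ-< p x<z , to (shift per t≤x t≤z) s) ◅ forth t≤z ss
      where
      t≤z = ≤-trans t≤x (<⇒≤ x<z)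

    back : ∀ {x x′ y′} → t ≤ x → Ascent x′ y′ → x′ ≡ p + x → y′ ≡ p + y → Ascent x y
    back {x} t≤x ε x′≡ y′≡ = subst (Ascent x) (+-cancelˡ-≡ p x y (trans (sym x′≡) y′≡)) ε
    back {x} t≤x (_◅_ {j = z′} (x<z , s) ss) refl y′≡ with difference {p} {z′} (m+n≤o⇒m≤o p (<⇒≤ x<z))
    ... | z , z′≡ with trans z′≡ (+-comm z p)
    ... | refl = (x<z₀ , from (shift per t≤x t≤z) s) ◅ back t≤z ss refl y′≡
      where
      x<z₀ : x < z
      x<z₀ = +-cancelˡ-< p _ _ x<z
      t≤z = ≤-trans t≤x (<⇒≤ x<z₀)

  ascent-shift-* : ∀ k → t ≤ x → Ascent x y ⇔ Ascent (k * p + x) (k * p + y)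
  ascent-shift-* zero t≤x = ⇔-refl
  ascent-shift-* {x} {y} (suc k) t≤x = ⇔-trans (ascent-shift-* k t≤x)
    (⇔-trans (ascent-shift (m≤n⇒m≤o+n (k * p) t≤x))
    (≡⇒⇔ (cong₂ Ascent (sym (+-assoc p (k * p) x)) (sym (+-assoc p (k * p) y)))))

  ascent-eventuallyPeriodic : let N = 2 ^ (p + t) in
    EventuallyPeriodic (N * p + suc t) (N ! * p) (Star (Ascending S))
  ascent-eventuallyPeriodic = record
    { shift = λ T≤x _ → ascent-shift-* (M !) (≤-trans (m≤n⇒m≤o+n (M * p) (n≤1+n t)) T≤x)
    -- The threshold for ascents from `x` exceeds `x` by a constant, as this clause requires.
    ; right = λ {x} {y} T+x≤y → ascent-periodic x (subst (_≤ y) (+-assoc (M * p) (suc t) x) T+x≤y)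
    -- Ascents never end below their start, so both sides are empty.
    ; left  = λ {y} {x} T+y≤x → mk⇔
        (λ ss → contradiction (ascending-≤ ss) (<⇒≱ (y<x T+y≤x)))
        (λ ss → contradiction (ascending-≤ ss) (<⇒≱ (m≤n⇒m≤o+n (M ! * p) (y<x T+y≤x))))
    }
    where
    M : ℕ
    M = 2 ^ (p + t)
    y<x : ∀ {x y} → M * p + suc t + y ≤ x → y < x
    y<x {y = y} T+y≤x = ≤-trans (+-monoˡ-≤ y (m≤n⇒m≤o+n (M * p) (s≤s (z≤n {t})))) T+y≤x

-- Periodicity of the reflexive and transitive closure

record PeriodicDecidable (S : Rel ℕ 0ℓ) : Set where
  field
    threshold period : ℕ
    {{period≢0}}     : NonZero period
    periodic         : EventuallyPeriodic threshold period S
    decidable        : Decidable₂ S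

eventuallyPeriodic-⇔ : ∀ {S T} → (∀ {x y} → S x y ⇔ T x y) → EventuallyPeriodic t p S → EventuallyPeriodic t p T
eventuallyPeriodic-⇔ S⇔T per = record
  { shift = λ t≤x t≤y → ⇔-trans (⇔-sym S⇔T) (⇔-trans (shift per t≤x t≤y) S⇔T)
  ; right = λ t+x≤y → ⇔-trans (⇔-sym S⇔T) (⇔-trans (right per t+x≤y) S⇔T)
  ; left  = λ t+y≤x → ⇔-trans (⇔-sym S⇔T) (⇔-trans (left per t+y≤x) S⇔T)
  }

-- `S` and its saturation connect the same points, and since the saturation is closed under peaks,
-- its paths reduce to valleys.
Star-periodicDecidable : PeriodicDecidable S → PeriodicDecidable (Star S)
Star-periodicDecidable {S} pres with saturation-stabilises (PeriodicDecidable.periodic pres) (PeriodicDecidable.decidable pres)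
... | k , closed = record
  { period≢0  = m*n≢0 ((2 ^ (period + threshold)) !) period {{_!≢0 (2 ^ (period + threshold))}}
  ; periodic  = eventuallyPeriodic-⇔ Valley⇔Star (Valley-periodic
      (ascent-eventuallyPeriodic (flip-periodic Ŝ-periodic) (flip Ŝ?)) (ascent-eventuallyPeriodic Ŝ-periodic Ŝ?))
  ; decidable = λ x y → map′ (to Valley⇔Star) (from Valley⇔Star)
      (Valley? (ascent? (flip-periodic Ŝ-periodic) (flip Ŝ?)) (ascent? Ŝ-periodic Ŝ?) x y)
  }
  where
  open PeriodicDecidable pres
  Ŝ = saturate S k
  Ŝ-periodic = saturate-periodic periodic k
  Ŝ? = saturate? periodic decidable k
  Valley⇔Star : Valley (Star (Ascending (flip Ŝ))) (Star (Ascending Ŝ)) x y ⇔ Star S x y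
  Valley⇔Star = mk⇔ (Star.concat ∘ Star.map (saturate⇒Star k) ∘ Valley⇒Star)
                    (Star⇒Valley closed ∘ Star.map (saturate-mono {S = S} (z≤n {k})))

-- Convolutions of unary words

Letter : Set
Letter = Vec (Maybe (Fin 1)) 2

pattern aa = just zero ∷ just zero ∷ []
pattern $a = nothing ∷ just zero ∷ []
pattern a$ = just zero ∷ nothing ∷ []

word : ℕ → List (Fin 1)
word n = replicate n zero

word-length : ∀ w → word (length w) ≡ w
word-length []         = refl
word-length (zero ∷ w) = cong (zero ∷_) (word-length w)

applyUpTo-constant : ∀ {f : ℕ → A} {c} n → (∀ {j} → j < n → f j ≡ c) → applyUpTo f n ≡ replicate n c
applyUpTo-constant zero    f≡c = refl
applyUpTo-constant (suc n) f≡c = cong₂ _∷_ (f≡c z<s) (applyUpTo-constant n (f≡c ∘ s<s))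

head-drop-[] : ∀ j → head (drop {A = A} j []) ≡ nothing
head-drop-[] zero    = refl
head-drop-[] (suc j) = refl

head-drop-word : ∀ {j} → j < n → head (drop j (word n)) ≡ just zero
head-drop-word {suc n} {zero}  _         = refl
head-drop-word {suc n} {suc j} (s<s j<n) = head-drop-word j<n

conv-∷ : ∀ m n → conv (word (suc m) ∷ word (suc n) ∷ []) ≡ aa ∷ conv (word m ∷ word n ∷ [])
-- Both sides compute to the same word up to the final `⊔ 0` of the fold, which reduces by itself
-- only on a successor.
conv-∷ m n = cong (λ l → aa ∷ applyUpTo (λ j → Vec.map (λ w → head (drop j w)) (word m ∷ word n ∷ [])) (length (word m) ⊔ l))
                  (sym (⊔-identityʳ (length (word n))))

conv-[]ˡ : ∀ n → conv ([] ∷ word n ∷ []) ≡ replicate n $a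
conv-[]ˡ n = trans (cong (applyUpTo _) (trans (⊔-identityʳ _) (length-replicate n)))
  (applyUpTo-constant n λ {j} j<n → cong₂ (λ a b → a ∷ b ∷ []) (head-drop-[] j) (head-drop-word j<n))

conv-[]ʳ : ∀ n → conv (word n ∷ [] ∷ []) ≡ replicate n a$
conv-[]ʳ n = trans (cong (applyUpTo _) (trans (⊔-identityʳ _) (length-replicate n)))
  (applyUpTo-constant n λ {j} j<n → cong₂ (λ a b → a ∷ b ∷ []) (head-drop-word j<n) (head-drop-[] j))

conv-right : ∀ m d → conv (word m ∷ word (d + m) ∷ []) ≡ replicate m aa ++ replicate d $a
conv-right zero    d rewrite +-identityʳ d = conv-[]ˡ d
conv-right (suc m) d rewrite +-suc d m     = trans (conv-∷ m (d + m)) (cong (aa ∷_) (conv-right m d))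

conv-left : ∀ m d → conv (word (d + m) ∷ word m ∷ []) ≡ replicate m aa ++ replicate d a$
conv-left zero    d rewrite +-identityʳ d = conv-[]ʳ d
conv-left (suc m) d rewrite +-suc d m     = trans (conv-∷ (d + m) m) (cong (aa ∷_) (conv-left m d))

catMaybes-head-drop : ∀ (w : List A) {n} → length w ≤ n → catMaybes (applyUpTo (λ j → head (drop j w)) n) ≡ w
catMaybes-head-drop []      {n}     _         =
  trans (cong catMaybes (applyUpTo-constant n λ {j} _ → head-drop-[] j)) (catMaybes-nothing n)
  where
  catMaybes-nothing : ∀ n → catMaybes (replicate n nothing) ≡ []
  catMaybes-nothing zero    = refl
  catMaybes-nothing (suc n) = catMaybes-nothing n
catMaybes-head-drop (a ∷ w) {suc n} (s≤s w≤n) = cong (a ∷_) (catMaybes-head-drop w w≤n)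

-- Each track of a convolution, stripped of padding, gives back its word.
conv-injective : {u v u′ v′ : List A} → conv (u ∷ v ∷ []) ≡ conv (u′ ∷ v′ ∷ []) → u ≡ u′ × v ≡ v′
conv-injective {A} {u} {v} {u′} {v′} eq =
  trans (sym (first u v)) (trans (cong (catMaybes ∘ List.map Vec.head) eq) (first u′ v′)) ,
  trans (sym (second u v)) (trans (cong (catMaybes ∘ List.map (Vec.head ∘ Vec.tail)) eq) (second u′ v′))
  where
  letters : List A → List A → ℕ → Vec (Maybe A) 2
  letters u v j = Vec.map (λ w → head (drop j w)) (u ∷ v ∷ [])
  first : ∀ u v → catMaybes (List.map Vec.head (conv (u ∷ v ∷ []))) ≡ u
  first u v = trans (cong catMaybes (map-applyUpTo (letters u v) Vec.head (length u ⊔ (length v ⊔ 0))))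
    (catMaybes-head-drop u (m≤m⊔n (length u) (length v ⊔ 0)))
  second : ∀ u v → catMaybes (List.map (Vec.head ∘ Vec.tail) (conv (u ∷ v ∷ []))) ≡ v
  second u v = trans (cong catMaybes (map-applyUpTo (letters u v) (Vec.head ∘ Vec.tail) (length u ⊔ (length v ⊔ 0))))
    (catMaybes-head-drop v (≤-trans (m≤m⊔n (length v) 0) (m≤n⊔m (length u) (length v ⊔ 0))))

-- From automata to eventually periodic relations

-- An orbit that meets an earlier point repeats from there on; the recurrence lemma applies with
-- step `1` and offset `0`.
orbit-periodic : (f : Fin N → Fin N) (q : Fin N) (P : Pred (Fin N) 0ℓ) →
                 Periodic (N * 1 + 0) (N ! * 1) (λ n → P (fold q f n))
orbit-periodic f q P = recurrent⇒periodic {P = λ n → P (fold q f n)} (fold q f) recur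
  where
  recur : ∀ i e → fold q f i ≡ fold q f (suc e + i) →
          Periodic (i * 1 + 0) (suc e * 1) (λ n → P (fold q f n))
  recur i e eq {n} i≤n rewrite +-identityʳ (i * 1) | *-identityʳ i | *-identityʳ e with difference i≤n
  ... | k , refl = ≡⇒⇔ (cong P (begin
    fold q f (k + i)                ≡⟨ fold-+ q f k ⟩
    fold (fold q f i) f k           ≡⟨ cong (λ s → fold s f k) eq ⟩
    fold (fold q f (suc e + i)) f k ≡⟨ fold-+ q f k ⟨
    fold q f (k + (suc e + i))      ≡⟨ cong (fold q f) (+-swap k (suc e) i) ⟩
    fold q f (suc e + (k + i))      ∎))
    where open ≡-Reasoning

eventuallyPeriodic :
  (∀ x → Periodic t p (λ d → S x (d + x))) → (∀ d → Periodic t p (λ x → S x (d + x))) →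
  (∀ x → Periodic t p (λ d → S (d + x) x)) → (∀ d → Periodic t p (λ x → S (d + x) x)) →
  EventuallyPeriodic t p S
eventuallyPeriodic {t} {p} {S} right-offset right-diagonal left-offset left-diagonal = record
  { shift = λ {x} {y} t≤x t≤y → [ shift-upper t≤x , shift-lower t≤y ]′ (≤-total x y)
  ; right = right-⇔
  ; left  = left-⇔
  }
  where
  shift-upper : t ≤ x → x ≤ y → S x y ⇔ S (p + x) (p + y)
  shift-upper {x} t≤x x≤y with difference x≤y
  ... | d , refl = ⇔-trans (right-diagonal d t≤x) (≡⇒⇔ (cong (S (p + x)) (+-swap d p x)))
  shift-lower : t ≤ y → y ≤ x → S x y ⇔ S (p + x) (p + y)
  shift-lower {y} t≤y y≤x with difference y≤x
  ... | d , refl = ⇔-trans (left-diagonal d t≤y) (≡⇒⇔ (cong (λ x → S x (p + y)) (+-swap d p y)))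
  right-⇔ : t + x ≤ y → S x y ⇔ S x (p + y)
  right-⇔ {x} t+x≤y with difference (m+n≤o⇒n≤o t t+x≤y)
  ... | d , refl = ⇔-trans (right-offset x (+-cancelʳ-≤ x t d t+x≤y)) (≡⇒⇔ (cong (S x) (+-assoc p d x)))
  left-⇔ : t + y ≤ x → S x y ⇔ S (p + x) y
  left-⇔ {y} t+y≤x with difference (m+n≤o⇒n≤o t t+y≤x)
  ... | d , refl = ⇔-trans (left-offset y (+-cancelʳ-≤ y t d t+y≤x)) (≡⇒⇔ (cong (λ x → S x y) (+-assoc p d y)))

foldl-replicate : {B : Set} (f : B → A → B) (b : B) (a : A) → ∀ n →
                  foldl f b (replicate n a) ≡ fold b (λ b → f b a) n
foldl-replicate f b a zero    = refl
foldl-replicate f b a (suc n) = trans (foldl-replicate f (f b a) a n)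
  (trans (sym (fold-+ b (λ b → f b a) n)) (cong (fold b (λ b → f b a)) (+-comm n 1)))

module _ (M : DFA Letter) where
  open DFA M renaming (states to k)

  AcceptedPair : Rel ℕ 0ℓ
  AcceptedPair x y = Accepted (conv (word x ∷ word y ∷ []))

  private
    f : Letter → Fin k → Fin k
    f a s = step s a

    run-replicate : ∀ m n a b → foldl step start (replicate m a ++ replicate n b) ≡ fold (fold start (f a) m) (f b) n
    run-replicate m n a b = trans (foldl-++ step start (replicate m a) (replicate n b))
      (trans (cong (λ s → foldl step s (replicate n b)) (foldl-replicate step start a m))
             (foldl-replicate step _ b n))

    accepted-right : ∀ d x → T (final (fold (fold start (f aa) x) (f $a) d)) ⇔ AcceptedPair x (d + x)
    accepted-right d x = ≡⇒⇔ (cong (T ∘ final) (sym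
      (trans (cong (foldl step start) (conv-right x d)) (run-replicate x d aa $a))))

    accepted-left : ∀ d x → T (final (fold (fold start (f aa) x) (f a$) d)) ⇔ AcceptedPair (d + x) x
    accepted-left d x = ≡⇒⇔ (cong (T ∘ final) (sym
      (trans (cong (foldl step start) (conv-left x d)) (run-replicate x d aa a$))))

    conjugate : {A B C D : Set} → A ⇔ B → C ⇔ D → A ⇔ C → B ⇔ D
    conjugate e g h = ⇔-trans (⇔-sym e) (⇔-trans h g)

  -- The automaton iterates the map of `aa` over the common part, then that of one padded letter
  -- over the excess. All these orbits live in the same `k` states, so one threshold and one period
  -- serve them all.
  accepted-periodicDecidable : PeriodicDecidable AcceptedPair
  accepted-periodicDecidable = record
    { period≢0  = m*n≢0 (k !) 1 {{k !≢0}}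
    ; periodic  = eventuallyPeriodic
        (λ x {d} k≤d → conjugate (accepted-right d x) (accepted-right (k ! * 1 + d) x)
          (orbit-periodic (f $a) (fold start (f aa) x) (T ∘ final) k≤d))
        (λ d {x} k≤x → conjugate (accepted-right d x) (accepted-right d (k ! * 1 + x))
          (orbit-periodic (f aa) start (λ s → T (final (fold s (f $a) d))) k≤x))
        (λ x {d} k≤d → conjugate (accepted-left d x) (accepted-left (k ! * 1 + d) x)
          (orbit-periodic (f a$) (fold start (f aa) x) (T ∘ final) k≤d))
        (λ d {x} k≤x → conjugate (accepted-left d x) (accepted-left d (k ! * 1 + x))
          (orbit-periodic (f aa) start (λ s → T (final (fold s (f a$) d))) k≤x))
    ; decidable = λ x y → T? _
    }

-- From eventually periodic relations to automata

module _ {Q Σ : Set} (finite : Fin n ↔ Q) (start : Q) (step : Q → Σ → Q) (final : Q → Bool) where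
  private module F = Inverse finite

  finiteDFA : DFA Σ
  finiteDFA = record
    { states = n
    ; start  = F.from start
    ; step   = λ s a → F.from (step (F.to s) a)
    ; final  = final ∘ F.to
    }

  finiteDFA-accepted : ∀ w → DFA.Accepted finiteDFA w ≡ T (final (foldl step start w))
  finiteDFA-accepted w = cong (T ∘ final) (run start w)
    where
    run : ∀ q w → F.to (foldl (DFA.step finiteDFA) (F.from q) w) ≡ foldl step q w
    run q []      = F.strictlyInverseˡ q
    run q (a ∷ w) rewrite F.strictlyInverseˡ q = run (step q a) w

module _ (pres : PeriodicDecidable S) where
  open PeriodicDecidable pres

  private
    K : ℕ
    K = period + threshold

    r : ℕ → Fin K
    r = rep threshold period

    next : Fin K → Fin K
    next = wrap threshold period

    -- The states record the common length and the excess of the longer word, each up to its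
    -- representative; the sink takes whatever is not a convolution.
    State : Set
    State = Fin 1 ⊎ Fin K ⊎ (Fin K × Fin K) ⊎ (Fin K × Fin K)

    pattern reject           = inj₁ zero
    pattern equal i          = inj₂ (inj₁ i)
    pattern rightLonger i d  = inj₂ (inj₂ (inj₁ (i , d)))
    pattern leftLonger i d   = inj₂ (inj₂ (inj₂ (i , d)))

    finite : Fin (1 + (K + (K * K + K * K))) ↔ State
    finite = ↔-trans +↔⊎ (↔-refl ⊎-↔ ↔-trans +↔⊎ (↔-refl ⊎-↔ ↔-trans +↔⊎ (*↔× ⊎-↔ *↔×)))

    δ : State → Letter → State
    δ (equal i)         aa = equal (next i)
    -- The first padded letter already counts towards the excess, which therefore starts at `1`.
    δ (equal i)         $a = rightLonger i (r 1)
    δ (equal i)         a$ = leftLonger i (r 1)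
    δ (rightLonger i d) $a = rightLonger i (next d)
    δ (leftLonger i d)  a$ = leftLonger i (next d)
    δ _                 _  = reject

    final? : State → Bool
    final? reject            = false
    final? (equal i)         = ⌊ decidable (toℕ i) (toℕ i) ⌋
    final? (rightLonger i d) = ⌊ decidable (toℕ i) (toℕ d + toℕ i) ⌋
    final? (leftLonger i d)  = ⌊ decidable (toℕ d + toℕ i) (toℕ i) ⌋

    Accepting : State → Pred (List Letter) 0ℓ
    Accepting q w = T (final? (foldl δ q w))

    witness : {A : Set} {a? : Dec A} → T ⌊ a? ⌋ ⇔ A
    witness = mk⇔ toWitness fromWitness

    run-aa : ∀ m i w → foldl δ (equal (r i)) (replicate m aa ++ w) ≡ foldl δ (equal (r (m + i))) w
    run-aa zero    i w = refl
    run-aa (suc m) i w = trans (run-aa m (suc i) w) (cong (λ i → foldl δ (equal (r i)) w) (+-suc m i))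

    run-$a : ∀ d i e → foldl δ (rightLonger i (r e)) (replicate d $a) ≡ rightLonger i (r (d + e))
    run-$a zero    i e = refl
    run-$a (suc d) i e = trans (run-$a d i (suc e)) (cong (rightLonger i ∘ r) (+-suc d e))

    run-a$ : ∀ d i e → foldl δ (leftLonger i (r e)) (replicate d a$) ≡ leftLonger i (r (d + e))
    run-a$ zero    i e = refl
    run-a$ (suc d) i e = trans (run-a$ d i (suc e)) (cong (leftLonger i ∘ r) (+-suc d e))

    accepting-$a : ∀ m d → Accepting (equal (r m)) (replicate d $a) ⇔ S m (d + m)
    accepting-$a m zero    = ⇔-trans witness
      (⇔-sym (rep-⇔ threshold period {λ x → S x x} (diagonal-periodic periodic 0) m))
    accepting-$a m (suc d) = ⇔-trans
      (≡⇒⇔ (cong (T ∘ final?) (trans (run-$a d (r m) 1) (cong (rightLonger (r m) ∘ r) (+-comm d 1)))))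
      (⇔-trans witness (⇔-sym (rep₂-⇔ periodic m (suc d))))

    accepting-a$ : ∀ m d → Accepting (equal (r m)) (replicate d a$) ⇔ S (d + m) m
    accepting-a$ m zero    = accepting-$a m zero
    accepting-a$ m (suc d) = ⇔-trans
      (≡⇒⇔ (cong (T ∘ final?) (trans (run-a$ d (r m) 1) (cong (leftLonger (r m) ∘ r) (+-comm d 1)))))
      (⇔-trans witness (⇔-sym (rep₂-⇔ (flip-periodic periodic) m (suc d))))

    accepting-conv : ∀ m n → Accepting (equal (r 0)) (conv (word m ∷ word n ∷ [])) ⇔ S m n
    accepting-conv m n with ≤-total m n
    ... | inj₁ m≤n with difference m≤n
    ...   | d , refl = ⇔-trans
      (≡⇒⇔ (cong (T ∘ final?) (trans (cong (foldl δ _) (conv-right m d)) (run-aa m 0 _))))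
      (subst (λ x → Accepting (equal (r x)) (replicate d $a) ⇔ S m (d + m)) (sym (+-identityʳ m)) (accepting-$a m d))
    accepting-conv m n | inj₂ n≤m with difference n≤m
    ...   | d , refl = ⇔-trans
      (≡⇒⇔ (cong (T ∘ final?) (trans (cong (foldl δ _) (conv-left n d)) (run-aa n 0 _))))
      (subst (λ x → Accepting (equal (r x)) (replicate d a$) ⇔ S (d + n) n) (sym (+-identityʳ n)) (accepting-a$ n d))

    reject-rejects : ∀ w → foldl δ reject w ≡ reject
    reject-rejects []      = refl
    reject-rejects (_ ∷ w) = reject-rejects w

    absurd : ∀ {C : Set} w → Accepting reject w → C
    absurd w acc with subst (T ∘ final?) (reject-rejects w) acc
    ... | ()

    accepting⇒$a : ∀ i d w → Accepting (rightLonger i d) w → ∃ λ n → replicate n $a ≡ w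
    accepting⇒$a i d []       acc = 0 , refl
    accepting⇒$a i d ($a ∷ w) acc = let n , eq = accepting⇒$a i (next d) w acc in suc n , cong ($a ∷_) eq
    accepting⇒$a i d (aa ∷ w) acc = absurd w acc
    accepting⇒$a i d (a$ ∷ w) acc = absurd w acc
    accepting⇒$a i d ((nothing ∷ nothing ∷ []) ∷ w) acc = absurd w acc

    accepting⇒a$ : ∀ i d w → Accepting (leftLonger i d) w → ∃ λ n → replicate n a$ ≡ w
    accepting⇒a$ i d []       acc = 0 , refl
    accepting⇒a$ i d (a$ ∷ w) acc = let n , eq = accepting⇒a$ i (next d) w acc in suc n , cong (a$ ∷_) eq
    accepting⇒a$ i d (aa ∷ w) acc = absurd w acc
    accepting⇒a$ i d ($a ∷ w) acc = absurd w acc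
    accepting⇒a$ i d ((nothing ∷ nothing ∷ []) ∷ w) acc = absurd w acc

    -- Letters out of order lead to the sink, so an accepted word is a block of `aa` followed by
    -- padding on at most one track.
    accepting⇒conv : ∀ i w → Accepting (equal i) w → ∃₂ λ m n → conv (word m ∷ word n ∷ []) ≡ w
    accepting⇒conv i []       acc = 0 , 0 , refl
    accepting⇒conv i (aa ∷ w) acc =
      let m , n , eq = accepting⇒conv (next i) w acc in suc m , suc n , trans (conv-∷ m n) (cong (aa ∷_) eq)
    accepting⇒conv i ($a ∷ w) acc =
      let n , eq = accepting⇒$a i (r 1) w acc in 0 , suc n , trans (conv-[]ˡ (suc n)) (cong ($a ∷_) eq)
    accepting⇒conv i (a$ ∷ w) acc =
      let n , eq = accepting⇒a$ i (r 1) w acc in suc n , 0 , trans (conv-[]ʳ (suc n)) (cong (a$ ∷_) eq)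
    accepting⇒conv i ((nothing ∷ nothing ∷ []) ∷ w) acc = absurd w acc

  periodicDecidable⇒regular : {X : Pred (Vec (List (Fin 1)) 2) ℓ} →
    (∀ m n → S m n ⇔ X (word m ∷ word n ∷ [])) → RegularRelation X
  periodicDecidable⇒regular {X = X} S⇔X = finiteDFA finite (equal (r 0)) δ final? , sound , complete
    where
    accepted≡ = finiteDFA-accepted finite (equal (r 0)) δ final?

    sound : ∀ {w} → DFA.Accepted (finiteDFA finite (equal (r 0)) δ final?) w → ∃ λ ws → X ws × conv ws ≡ w
    sound {w} acc with subst id (accepted≡ w) acc
    ... | acc′ with accepting⇒conv (r 0) w acc′
    ... | m , n , refl = word m ∷ word n ∷ [] , to (S⇔X m n) (to (accepting-conv m n) acc′) , refl

    complete : ∀ {w} → (∃ λ ws → X ws × conv ws ≡ w) → DFA.Accepted (finiteDFA finite (equal (r 0)) δ final?) w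
    complete (u ∷ v ∷ [] , Xuv , refl) = subst id (sym (accepted≡ (conv (u ∷ v ∷ []))))
      (subst₂ (λ u v → Accepting (equal (r 0)) (conv (u ∷ v ∷ []))) (word-length u) (word-length v)
        (from (accepting-conv (length u) (length v)) (from (S⇔X (length u) (length v))
          (subst₂ (λ u v → X (u ∷ v ∷ [])) (sym (word-length u)) (sym (word-length v)) Xuv))))

-- Transfer between numbers and elements of the structure

module _ {C : Set ℓ} (φ : Words {k = 1} U → C) where

  element : ℕ → C
  element n = φ (word n ,ʳ [ tt ])

  Λ-word : ∀ (R : Pred (Vec C 2) ℓ) m n → Λ R φ (word m ∷ word n ∷ []) ⇔ R (element m ∷ element n ∷ [])
  Λ-word R m n = mk⇔ (λ { (_ ∷ _ ∷ [] , refl , r) → r }) (λ r → (_ ∷ _ ∷ []) , refl , r)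

  -- Surjectivity names the intermediate points of a path in the structure; injectivity identifies
  -- the two names of its endpoint.
  Star-element : Surjective _≡_ _≡_ φ → Injective _≡_ _≡_ φ → {R : Rel C ℓ} {S : Rel ℕ 0ℓ} →
    (∀ m n → S m n ⇔ R (element m) (element n)) → ∀ m n → Star S m n ⇔ Star R (element m) (element n)
  Star-element surj inj {R} {S} S⇔R m n = mk⇔ (Star.gmap element (to (S⇔R _ _))) (λ ss → go ss refl refl)
    where
    word-injective : ∀ {m n} → word m ≡ word n → m ≡ n
    word-injective {m} {n} eq = trans (sym (length-replicate m)) (trans (cong length eq) (length-replicate n))

    name : ∀ c → ∃ λ n → c ≡ element n
    name c with surj c
    ... | (w ,ʳ _) , φw≡c = length w , sym (φw≡c (cong (_,ʳ [ tt ]) (word-length w)))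

    go : ∀ {b c m} → Star R b c → b ≡ element m → c ≡ element n → Star S m n
    go {m = m} ε b≡ c≡ = subst (Star S m) (word-injective (cong value (inj (trans (sym b≡) c≡)))) ε
    go (_◅_ {j = d} s ss) refl c≡ with name d
    ... | k , refl = from (S⇔R _ k) s ◅ go ss refl c≡

⋆-regular : {C : Set ℓ} (φ : Words {k = 1} U → C) → Surjective _≡_ _≡_ φ → Injective _≡_ _≡_ φ →
            (R : Pred (Vec C 2) ℓ) → RegularRelation (Λ R φ) → RegularRelation (Λ (R ⋆) φ)
⋆-regular φ surj inj R (M , sound , complete) =
  periodicDecidable⇒regular (Star-periodicDecidable (accepted-periodicDecidable M)) λ m n →
    ⇔-trans (Star-element φ surj inj accepted⇔R m n) (⇔-sym (Λ-word φ (R ⋆) m n))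
  where
  accepted⇔R : ∀ m n → AcceptedPair M m n ⇔ R (element φ m ∷ element φ n ∷ [])
  accepted⇔R m n = mk⇔ forth (λ r → complete (_ , from (Λ-word φ R m n) r , refl))
    where
    forth : AcceptedPair M m n → R (element φ m ∷ element φ n ∷ [])
    forth acc with sound acc
    -- Acceptance yields some pair with this convolution; injectivity of `conv` shows that it is the
    -- given one.
    ... | u ∷ v ∷ [] , Λuv , eq with conv-injective {u = u} {v} {word m} {word n} eq
    ... | refl , refl = to (Λ-word φ R m n) Λuv

theorem4p1 : {ℓ : Level} (𝒮 : Structure ℓ) →
    (φ : Words {k = 1} U → Structure.Carrier 𝒮) →
    IsFAPresentation 𝒮 U φ →
    Injective _≡_ _≡_ φ →
    (R : Pred (Vec (Structure.Carrier 𝒮) 2) ℓ) →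
    (2 , R) ∈ Structure.relations 𝒮 →
    RegularRelation (Λ (R ⋆) φ) × UnaryFAPresentable (augment 𝒮 (R ⋆))
theorem4p1 𝒮 φ presentation inj R R∈𝒮 = R⋆-regular , U , φ , record
  { regular          = regular
  ; surjective       = surjective
  ; equalityRegular  = equalityRegular
  ; relationsRegular = ∷ʳ⁺ relationsRegular R⋆-regular
  }
  where
  open IsFAPresentation presentation
  R⋆-regular = ⋆-regular φ surjective inj R (All.lookup relationsRegular R∈𝒮)
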